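{- Let $n \geq 7$ be odd, and let $\omega_n := (1, 3, \ldots, n, n-1, n-3, \ldots, 2)$ be the cyclic order on $\{1,\ldots,n\}$ listing the odd numbers increasingly and then the even numbers decreasingly. Then $C(n,\{2,3\})$ is nearly dispersable with respect to $\omega_n$.
   Context: All graphs are finite and simple. For a set $S=\{i_1<\cdots<i_k\}$ of integers with $k\ge 1$, $1\le i_1$ and $i_k\le \lfloor n/2\rfloor$, the circulant $C(n,S)$ is the graph on vertex set $\{1,\ldots,n\}$ in which each $j$ is adjacent to $j+i_r$ (addition mod $n$) for $r=1,\ldots,k$. Given a graph $G$ and a cyclic order $\omega$ on $V(G)$, draw the vertices on a circle in the order $\omega$ and the edges as straight chords; two edges cross if they intersect at a point that is not an endpoint. A matching book embedding $(G,\omega,c)$ consists of $G$, a cyclic order $\omega$, and an edge-coloring $c$ (the color classes are the pages) such that any two distinct edges of the same color neither cross nor share an endpoint. The embedding is dispersable if the number of colors equals the maximum degree $\Delta(G)$, and nearly dispersable if the number of colors equals $1+\Delta(G)$. A graph is dispersable if it has a dispersable matching book embedding; it is nearly dispersable if it is not dispersable and has a nearly dispersable matching book embedding. "Nearly dispersable with respect to $\omega$" means that the graph $G$ is not dispersable and has a nearly dispersable matching book embedding $(G,\omega,c)$ with this particular cyclic order $\omega$. -}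

module Defs where

open import Data.Fin using (Fin; toℕ; fromℕ<) renaming (_<_ to _<ᶠ_)
open import Data.Fin.Permutation using (Permutation′; permutation; _⟨$⟩ˡ_)
open import Data.Fin.Properties using (nonZeroIndex; toℕ<n; toℕ-fromℕ<; toℕ-injective)
open import Data.List using (List; []; _∷_; length; filter; map; allFin)
open import Data.List.Extrema.Nat using (max)
open import Data.List.Relation.Unary.All using (All; []; _∷_)
open import Data.List.Relation.Unary.Any using (Any; any?; here; there)
import Data.List.Relation.Unary.Any as Any
open import Data.List.Relation.Unary.Linked using (Linked; [-]; _∷_)
open import Data.Nat
open import Data.Nat.DivMod
open import Data.Nat.Properties
open import Data.Product using (∃-syntax; _×_; _,_)
open import Data.Sum using (_⊎_; inj₁; inj₂; swap)
open import Function.Definitions using (Surjective)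
open import Level using (0ℓ)
open import Relation.Binary using (Rel; Decidable; Symmetric)
open import Relation.Binary.PropositionalEquality
open import Relation.Nullary using (¬_; yes; no; contradiction)
open import Relation.Nullary.Decidable using (_⊎-dec_)

------------------------------------------------------------------------
-- Finite simple graphs

record Graph (n : ℕ) : Set₁ where
  field
    Adj     : Rel (Fin n) 0ℓ
    adj?    : Decidable Adj
    symm    : Symmetric Adj
    irrefl  : ∀ {v} → ¬ Adj v v

  -- An unordered edge is stored once, with its smaller endpoint first; the
  -- proofs are irrelevant, so an edge is determined by its two endpoints.
  record Edge : Set where
    constructor edge
    field
      src tgt  : Fin n
      .src<tgt : src <ᶠ tgt
      .adj     : Adj src tgt

  degree : Fin n → ℕ
  degree v = length (filter (adj? v) (allFin n))

  Δ : ℕ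
  Δ = max 0 (map degree (allFin n))

------------------------------------------------------------------------
-- Circulants

-- The vertices {1,…,n} are encoded by Fin n, the vertex j being the element
-- with toℕ equal to j - 1.
label : ∀ {n} → Fin n → ℕ
label v = suc (toℕ v)

-- v is u + s, addition mod n
Step : ∀ {n} → ℕ → Rel (Fin n) 0ℓ
Step {n} s u v = (label u + s) % n ≡ label v % n
  where instance _ = nonZeroIndex u

-- The set {i₁ < ⋯ < i_k} is given by the list of its elements.
record IsJumpSet (n : ℕ) (S : List ℕ) : Set where
  field
    nonempty   : 1 ≤ length S
    increasing : Linked _<_ S
    bounds     : All (λ s → 1 ≤ s × s ≤ ⌊ n /2⌋) S

step? : ∀ {n} s → Decidable (Step {n} s)
step? s u v = _ ≟ _

step-irrefl : ∀ {n s} {v : Fin n} → 1 ≤ s → s ≤ ⌊ n /2⌋ → ¬ Step s v v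
step-irrefl {n@(suc m)} {s} {v} 1≤s s≤ eq =
  <⇒≢ 1≤s (trans (sym s%n≡0) (m<n⇒m%n≡m (≤-<-trans s≤ (⌊n/2⌋<n m))))
  where
  open ≡-Reasoning
  a = label v
  q = a / n
  r = (a + s) / n

  qn+s≡rn : q * n + s ≡ r * n
  qn+s≡rn = +-cancelˡ-≡ (a % n) _ _ (begin
    a % n + (q * n + s)        ≡⟨ +-assoc (a % n) (q * n) s ⟨
    a % n + q * n + s          ≡⟨ cong (_+ s) (m≡m%n+[m/n]*n a n) ⟨
    a + s                      ≡⟨ m≡m%n+[m/n]*n (a + s) n ⟩
    (a + s) % n + r * n        ≡⟨ cong (_+ r * n) eq ⟩
    a % n + r * n              ∎)

  s%n≡0 : s % n ≡ 0
  s%n≡0 = begin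
    s % n              ≡⟨ [m+kn]%n≡m%n s q n ⟨
    (s + q * n) % n    ≡⟨ cong (_% n) (trans (+-comm s _) qn+s≡rn) ⟩
    (r * n) % n        ≡⟨ m*n%n≡0 r n ⟩
    0                  ∎

circulant : (n : ℕ) (S : List ℕ) → IsJumpSet n S → Graph n
circulant n S jumps = record
  { Adj    = λ u v → Any (λ s → Step s u v ⊎ Step s v u) S
  ; adj?   = λ u v → any? (λ s → step? s u v ⊎-dec step? s v u) S
  ; symm   = Any.map swap
  ; irrefl = irr (IsJumpSet.bounds jumps)
  }
  where
  irr : ∀ {T} {v : Fin n} → All (λ s → 1 ≤ s × s ≤ ⌊ n /2⌋) T →
        ¬ Any (λ s → Step s v v ⊎ Step s v v) T
  irr ((lo , hi) ∷ _) (here (inj₁ e)) = step-irrefl lo hi e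
  irr ((lo , hi) ∷ _) (here (inj₂ e)) = step-irrefl lo hi e
  irr (_ ∷ bs)        (there p)       = irr bs p

isJumpSet-2,3 : ∀ {n} → n ≥ 7 → IsJumpSet n (2 ∷ 3 ∷ [])
isJumpSet-2,3 n≥7 = record
  { nonempty   = s≤s z≤n
  ; increasing = ≤-refl ∷ [-]
  ; bounds     = (s≤s z≤n , ≤-trans (n≤1+n 2) 3≤) ∷ (s≤s z≤n , 3≤) ∷ []
  }
  where 3≤ = ⌊n/2⌋-mono n≥7

------------------------------------------------------------------------
-- Book embeddings

-- A cyclic order is given by a linear listing that it closes up: the
-- permutation sends a place on the circle to the vertex put there. Listings
-- that differ by a rotation are the same cyclic order; the relation Cross
-- below does not distinguish them.
CyclicOrder : ℕ → Set
CyclicOrder = Permutation′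

place : ∀ {n} → CyclicOrder n → Fin n → Fin n
place ω v = ω ⟨$⟩ˡ v

-- The places a and b cut the circle into two open arcs: the one Inside,
-- strictly between a and b in the listing, and the one Outside.
Inside Outside : ∀ {n} → (a b x : Fin n) → Set
Inside  a b x = (a <ᶠ x × x <ᶠ b) ⊎ (b <ᶠ x × x <ᶠ a)
Outside a b x = (x <ᶠ a × x <ᶠ b) ⊎ (a <ᶠ x × b <ᶠ x)

module _ {n : ℕ} (G : Graph n) where
  open Graph G
  open Edge

  -- Two straight chords meet at a point other than an endpoint exactly when
  -- the ends of one lie in different open arcs cut off by the other.
  Cross : CyclicOrder n → Rel Edge 0ℓ
  Cross ω e f =
    let a = place ω (src e)
        b = place ω (tgt e)
        c = place ω (src f)
        d = place ω (tgt f)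
    in (Inside a b c × Outside a b d) ⊎ (Outside a b c × Inside a b d)

  ShareEndpoint : Rel Edge 0ℓ
  ShareEndpoint e f =
    ∃[ v ] (v ≡ src e ⊎ v ≡ tgt e) × (v ≡ src f ⊎ v ≡ tgt f)

  -- Matching book embeddings with exactly k pages. The pages are the colour
  -- classes, so every colour is used.
  record MatchingBookEmbedding (ω : CyclicOrder n) (k : ℕ) : Set where
    field
      colour   : Edge → Fin k
      allUsed  : Surjective _≡_ _≡_ colour
      matching : ∀ e f → e ≢ f → colour e ≡ colour f →
                 ¬ Cross ω e f × ¬ ShareEndpoint e f

  Dispersable : Set
  Dispersable = ∃[ ω ] MatchingBookEmbedding ω Δ

  NearlyDispersableWrt : CyclicOrder n → Set
  NearlyDispersableWrt ω = ¬ Dispersable × MatchingBookEmbedding ω (1 + Δ)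

------------------------------------------------------------------------
-- The cyclic order 1, 3, 5, …, 6, 4, 2

-- Places and vertices are counted from 0, as toℕ does: place k
-- carries the label 2k + 1 as long as this is at most n, and 2(n - k) after.
zigzag : ℕ → ℕ → ℕ
zigzag n k with 2 * k <? n
... | yes _ = 2 * k
... | no  _ = 2 * (n ∸ k) ∸ 1

zigzag⁻¹ : ℕ → ℕ → ℕ
zigzag⁻¹ n v with v % 2 ≟ 0
... | yes _ = v / 2
... | no  _ = n ∸ suc (v / 2)

zigzag-low : ∀ {n k} → 2 * k < n → zigzag n k ≡ 2 * k
zigzag-low {n} {k} p with 2 * k <? n
... | yes _ = refl
... | no ¬p = contradiction p ¬p

zigzag-high : ∀ {n k} → n ≤ 2 * k → zigzag n k ≡ 2 * (n ∸ k) ∸ 1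
zigzag-high {n} {k} p with 2 * k <? n
... | yes q = contradiction p (<⇒≱ q)
... | no  _ = refl

zigzag⁻¹-even : ∀ n h → zigzag⁻¹ n (2 * h) ≡ h
zigzag⁻¹-even n h rewrite *-comm 2 h with h * 2 % 2 ≟ 0
... | yes _ = m*n/n≡m h 2
... | no ¬p = contradiction (m*n%n≡0 h 2) ¬p

zigzag⁻¹-odd : ∀ n h → zigzag⁻¹ n (1 + 2 * h) ≡ n ∸ suc h
zigzag⁻¹-odd n h rewrite *-comm 2 h with (1 + h * 2) % 2 ≟ 0
... | yes p = contradiction (trans (sym ([m+kn]%n≡m%n 1 h 2)) p) λ ()
... | no  _ = cong (λ t → n ∸ suc t) half
  where
  half : (1 + h * 2) / 2 ≡ h
  half = trans (+-distrib-/ 1 (h * 2) (subst (λ t → 1 + t < 2) (sym (m*n%n≡0 h 2)) ≤-refl))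
               (m*n/n≡m h 2)

data EvenOrOdd : ℕ → Set where
  even : ∀ h → EvenOrOdd (2 * h)
  odd  : ∀ h → EvenOrOdd (1 + 2 * h)

evenOrOdd : ∀ v → EvenOrOdd v
evenOrOdd zero    = even 0
evenOrOdd (suc v) with evenOrOdd v
... | even h = odd h
... | odd  h = subst EvenOrOdd (*-suc 2 h) (even (suc h))

2*suc∸1 : ∀ j → 2 * suc j ∸ 1 ≡ 1 + 2 * j
2*suc∸1 j = cong (_∸ 1) (*-suc 2 j)

zigzag< : ∀ {n k} → k < n → zigzag n k < n
zigzag< {n} {k} k<n with 2 * k <? n
... | yes p = p
... | no ¬p with n ∸ k in eq
...   | zero  = contradiction (m∸n≡0⇒m≤n eq) (<⇒≱ k<n)
...   | suc j = begin-strict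
        2 * suc j ∸ 1        ≡⟨ 2*suc∸1 j ⟩
        1 + 2 * j            <⟨ ≤-refl ⟩
        2 + 2 * j            ≡⟨ *-suc 2 j ⟨
        2 * suc j            ≡⟨ cong (2 *_) eq ⟨
        2 * (n ∸ k)          ≡⟨ *-distribˡ-∸ 2 n k ⟩
        2 * n ∸ 2 * k        ≤⟨ ∸-monoʳ-≤ (2 * n) (≮⇒≥ ¬p) ⟩
        2 * n ∸ n            ≡⟨ m+n∸m≡n n (n + 0) ⟩
        n + 0                ≡⟨ +-identityʳ n ⟩
        n                    ∎
  where open ≤-Reasoning

zigzag⁻¹< : ∀ {n v} → v < n → zigzag⁻¹ n v < n
zigzag⁻¹< {suc m} {v} v<n with v % 2 ≟ 0
... | yes _ = ≤-<-trans (m/n≤m v 2) v<n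
... | no  _ = s≤s (m∸n≤m m (v / 2))

zigzag-zigzag⁻¹ : ∀ {n v} → v < n → zigzag n (zigzag⁻¹ n v) ≡ v
zigzag-zigzag⁻¹ {n} {v} v<n with evenOrOdd v
... | even h rewrite zigzag⁻¹-even n h = zigzag-low v<n
... | odd  h rewrite zigzag⁻¹-odd n h = begin
      zigzag n (n ∸ suc h)          ≡⟨ zigzag-high high ⟩
      2 * (n ∸ (n ∸ suc h)) ∸ 1     ≡⟨ cong (λ t → 2 * t ∸ 1) (m∸[m∸n]≡n suc-h≤n) ⟩
      2 * suc h ∸ 1                 ≡⟨ 2*suc∸1 h ⟩
      1 + 2 * h                     ∎
  where
  open ≡-Reasoning
  2suc-h≤n : 2 * suc h ≤ n
  2suc-h≤n = subst (_≤ n) (sym (*-suc 2 h)) v<n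
  suc-h≤n : suc h ≤ n
  suc-h≤n = ≤-trans (m≤n*m (suc h) 2) 2suc-h≤n
  high : n ≤ 2 * (n ∸ suc h)
  high = subst (n ≤_) (sym (*-distribˡ-∸ 2 n (suc h)))
    (subst (_≤ 2 * n ∸ 2 * suc h) (trans (m+n∸m≡n n (n + 0)) (+-identityʳ n))
      (∸-monoʳ-≤ (2 * n) 2suc-h≤n))

zigzag⁻¹-zigzag : ∀ {n k} → k < n → zigzag⁻¹ n (zigzag n k) ≡ k
zigzag⁻¹-zigzag {n} {k} k<n with 2 * k <? n
... | yes _ = zigzag⁻¹-even n k
... | no  _ with n ∸ k in eq
...   | zero  = contradiction (m∸n≡0⇒m≤n eq) (<⇒≱ k<n)
...   | suc j = begin
        zigzag⁻¹ n (2 * suc j ∸ 1)   ≡⟨ cong (zigzag⁻¹ n) (2*suc∸1 j) ⟩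
        zigzag⁻¹ n (1 + 2 * j)       ≡⟨ zigzag⁻¹-odd n j ⟩
        n ∸ suc j                    ≡⟨ cong (n ∸_) eq ⟨
        n ∸ (n ∸ k)                  ≡⟨ m∸[m∸n]≡n (<⇒≤ k<n) ⟩
        k                            ∎
  where open ≡-Reasoning

ω : (n : ℕ) → CyclicOrder n
ω n = permutation to from to∘from from∘to
  where
  to from : Fin n → Fin n
  to   k = fromℕ< (zigzag<   (toℕ<n k))
  from v = fromℕ< (zigzag⁻¹< (toℕ<n v))

  to∘from : ∀ v → to (from v) ≡ v
  to∘from v = toℕ-injective (begin
    toℕ (to (from v))               ≡⟨ toℕ-fromℕ< _ ⟩
    zigzag n (toℕ (from v))         ≡⟨ cong (zigzag n) (toℕ-fromℕ< (zigzag⁻¹< (toℕ<n v))) ⟩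
    zigzag n (zigzag⁻¹ n (toℕ v))   ≡⟨ zigzag-zigzag⁻¹ (toℕ<n v) ⟩
    toℕ v                           ∎)
    where open ≡-Reasoning

  from∘to : ∀ k → from (to k) ≡ k
  from∘to k = toℕ-injective (begin
    toℕ (from (to k))               ≡⟨ toℕ-fromℕ< _ ⟩
    zigzag⁻¹ n (toℕ (to k))         ≡⟨ cong (zigzag⁻¹ n) (toℕ-fromℕ< (zigzag< (toℕ<n k))) ⟩
    zigzag⁻¹ n (zigzag n (toℕ k))   ≡⟨ zigzag⁻¹-zigzag (toℕ<n k) ⟩
    toℕ k                           ∎)
    where open ≡-Reasoning

{-# OPTIONS --safe #-}
module Submission where

-- If G is d-regular on an odd number of vertices, d ≥ 1, then G is not dispersable:
-- in a proper d-edge-colouring every colour occurs at every vertex, so each colour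
-- class would be a perfect matching. For the same reason d + 1 pages are all used.
--
-- For the 5 pages of C(n,{2,3}), n = 2 m + 1, count places from 0. An edge
-- j ~ j + 3 that does not wrap around has place sum 2 m - 1 (j odd) or 2 m + 2
-- (j even), so each of these two families consists of parallel chords and needs one
-- page. An edge j ~ j + 2 that does not wrap around joins neighbouring places p and
-- p + 1, so it crosses nothing; with a few exceptions at the ends of the two paths,
-- it goes to the third or the fifth page according to the parity of p. The five
-- edges that wrap around fit on the last three pages.

open import Data.Fin using (Fin; zero; toℕ; fromℕ<; punchOut) renaming (_<_ to _<ᶠ_)
open import Data.Fin.Patterns using (0F; 1F; 2F; 3F; 4F)
open import Data.Fin.Permutation using (permutation; _⟨$⟩ʳ_; inverseʳ)
import Data.Fin.Properties as Fin
open import Data.List using ([]; _∷_; filter; tabulate; allFin)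
open import Data.List.Extrema.Nat using (max≤v⁺; v≤max⁺)
open import Data.List.Membership.Propositional using (_∈_)
open import Data.List.Membership.Propositional.Properties
  using (∈-filter⁺; ∈-filter⁻; ∈-tabulate⁺; ∈-tabulate⁻; ∈-allFin)
open import Data.List.Membership.Propositional.Properties.WithK using (unique∧set⇒bag)
open import Data.List.Properties using (length-tabulate)
open import Data.List.Relation.Binary.BagAndSetEquality using (∼bag⇒↭)
open import Data.List.Relation.Binary.Permutation.Propositional.Properties using (↭-length)
import Data.List.Relation.Unary.All.Properties as All
open import Data.List.Relation.Unary.Any using (here; there)
import Data.List.Relation.Unary.Any.Properties as Any
import Data.List.Relation.Unary.Unique.Propositional.Properties as Unique
open import Data.Nat
  using (ℕ; suc; _+_; _*_; _∸_; _≤_; _<_; _≥_; z≤n; s≤s; s≤s⁻¹; _≟_;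
    NonZero; >-nonZero; >-nonZero⁻¹)
open import Data.Nat.Divisibility using (_∣_; divides)
open import Data.Nat.DivMod
open import Data.Nat.Properties
open import Data.Nat.Tactic.RingSolver using (solve-∀)
open import Algebra.Properties.CommutativeMonoid.Sum +-0-commutativeMonoid
  using (sum-syntax; sum-cong-≗; ∑-distrib-+; ∑-permute)
open import Data.Product using (∃-syntax; _×_; _,_; proj₁; proj₂; swap)
open import Data.Sum as Sum using (_⊎_; inj₁; inj₂)
open import Function using (_∘_; id; mk⇔)
open import Function.Definitions using (Injective; Surjective)
open import Relation.Binary using (tri<; tri≈; tri>; DecidableEquality)
open import Relation.Binary.PropositionalEquality
open import Relation.Nullary using (¬_; Dec; yes; no; contradiction; contradiction-irr)
open import Relation.Nullary.Decidable using (map′; recompute; decidable-stable)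
open import Defs

-- Pigeonhole and parity on finite sets.

injective⇒surjective : ∀ {n} {f : Fin n → Fin n} → Injective _≡_ _≡_ f → ∀ y → ∃[ x ] f x ≡ y
injective⇒surjective {suc n} {f} inj y with Fin.any? (λ x → f x Fin.≟ y)
... | yes hit = hit
-- A missed `y` can be punched out of the codomain, which leaves an injection into a smaller set.
... | no miss = contradiction
  (λ {i j} → inj ∘ Fin.punchOut-injective (≢f i) (≢f j))
  (Fin.<⇒notInjective {f = λ x → punchOut (≢f x)} (n<1+n n))
  where
  ≢f : ∀ x → y ≢ f x
  ≢f x y≡fx = miss (x , sym y≡fx)

-- Each orbit {v , f v} contains exactly one v with v < f v.
fixpointFree-involution⇒2∣ : ∀ {n} (f : Fin n → Fin n) →
  (∀ v → f (f v) ≡ v) → (∀ v → f v ≢ v) → 2 ∣ n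
fixpointFree-involution⇒2∣ {n} f f∘f f≢id = divides (∑[ v < n ] below v) (begin
  n                                              ≡⟨ *-identityʳ n ⟨
  n * 1                                          ≡⟨ ∑1 n ⟨
  ∑[ v < n ] 1                                   ≡⟨ sum-cong-≗ below+below∘f ⟨
  ∑[ v < n ] (below v + below (f v))             ≡⟨ ∑-distrib-+ below (below ∘ f) ⟩
  ∑[ v < n ] below v + ∑[ v < n ] below (f v)    ≡⟨ cong (∑[ v < n ] below v +_) (∑-permute below π) ⟨
  ∑[ v < n ] below v + ∑[ v < n ] below v        ≡⟨ cong (∑[ v < n ] below v +_) (+-identityʳ _) ⟨
  2 * (∑[ v < n ] below v)                       ≡⟨ *-comm 2 (∑[ v < n ] below v) ⟩
  (∑[ v < n ] below v) * 2                       ∎)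
  where
  open ≡-Reasoning

  ∑1 : ∀ m → (∑[ v < m ] 1) ≡ m * 1
  ∑1 0       = refl
  ∑1 (suc m) = cong suc (∑1 m)

  π = permutation f f f∘f f∘f

  below : Fin n → ℕ
  below v with v Fin.<? f v
  ... | yes _ = 1
  ... | no  _ = 0

  below+below∘f : ∀ v → below v + below (f v) ≡ 1
  below+below∘f v with v Fin.<? f v | f v Fin.<? f (f v)
  ... | yes v<fv | yes fv<ffv = contradiction (subst (f v <ᶠ_) (f∘f v) fv<ffv) (Fin.<-asym v<fv)
  ... | yes _    | no _       = refl
  ... | no _     | yes _      = refl
  ... | no v≮fv  | no fv≮ffv with Fin.<-cmp v (f v)
  ...   | tri< v<fv _ _ = contradiction v<fv v≮fv
  ...   | tri≈ _ v≡fv _ = contradiction (sym v≡fv) (f≢id v)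
  ...   | tri> _ _ fv<v = contradiction (subst (f v <ᶠ_) (sym (f∘f v)) fv<v) fv≮ffv

-- Edge-colourings of regular graphs of odd order.

module _ {n : ℕ} (G : Graph n) where
  open Graph G
  open Edge

  infix 4 _≟ᵉ_
  _≟ᵉ_ : DecidableEquality Edge
  edge u v _ _ ≟ᵉ edge u′ v′ _ _ with u Fin.≟ u′ | v Fin.≟ v′
  ... | yes refl | yes refl = yes refl
  ... | no u≢u′  | _        = no λ { refl → u≢u′ refl }
  ... | _        | no v≢v′  = no λ { refl → v≢v′ refl }

  -- Serves to test whether a colour occurs. The search runs over pairs of vertices; the irrelevant
  -- proofs inside an edge are recovered by decidability.
  anyEdge? : ∀ {P : Edge → Set} → (∀ e → Dec (P e)) → Dec (∃[ e ] P e)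
  anyEdge? {P} P? = map′
    (λ (u , v , u<v , u~v , p) → edge u v u<v u~v , p)
    (λ { (edge u v u<v u~v , p) → u , v , recompute (u Fin.<? v) u<v , recompute (adj? u v) u~v , p })
    (Fin.any? λ u → Fin.any? λ v → between? u v)
    where
    between? : ∀ u v → Dec (∃[ u<v ] ∃[ u~v ] P (edge u v u<v u~v))
    between? u v with u Fin.<? v | adj? u v
    ... | no u≮v  | _       = no (u≮v ∘ proj₁)
    ... | yes _   | no u≁v  = no (u≁v ∘ proj₁ ∘ proj₂)
    ... | yes u<v | yes u~v = map′ (λ p → u<v , u~v , p) (λ (_ , _ , p) → p) (P? _)

  -- An edge is stored with its smaller end first; this view reads it from either end.
  data Joins : Edge → Fin n → Fin n → Set where
    forward  : ∀ {u v} .{u<v : u <ᶠ v} .{u~v : Adj u v} → Joins (edge u v u<v u~v) u v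
    backward : ∀ {u v} .{u<v : u <ᶠ v} .{u~v : Adj u v} → Joins (edge u v u<v u~v) v u

  join : ∀ {u v} → Adj u v → ∃[ e ] Joins e u v
  join {u} {v} u~v with Fin.<-cmp u v
  ... | tri< u<v _ _  = edge u v u<v u~v , forward
  ... | tri≈ _ refl _ = contradiction u~v irrefl
  ... | tri> _ _ v<u  = edge v u v<u (symm u~v) , backward

  Joins-sym : ∀ {e u v} → Joins e u v → Joins e v u
  Joins-sym forward  = backward
  Joins-sym backward = forward

  Joins-functional : ∀ {e u v w} → Joins e u v → Joins e u w → v ≡ w
  Joins-functional forward  forward  = refl
  Joins-functional forward  backward = refl
  Joins-functional backward forward  = refl
  Joins-functional backward backward = refl

  Joins-irrefl : ∀ {e v} → ¬ Joins e v v
  Joins-irrefl (forward {u<v = u<u})  = contradiction-irr u<u (<-irrefl refl)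
  Joins-irrefl (backward {u<v = u<u}) = contradiction-irr u<u (<-irrefl refl)

  Joins⇒incident : ∀ {e u v} → Joins e u v → u ≡ src e ⊎ u ≡ tgt e
  Joins⇒incident forward  = inj₁ refl
  Joins⇒incident backward = inj₂ refl

  ProperColouring : ∀ {k} → (Edge → Fin k) → Set
  ProperColouring colour = ∀ e f → e ≢ f → colour e ≡ colour f → ¬ ShareEndpoint G e f

  -- Neighbours are numbered rather than counted, so that `d` colours at a vertex give a map from
  -- `Fin d` to itself.
  record Regular (d : ℕ) : Set where
    field
      nb           : Fin n → Fin d → Fin n
      nb-adj       : ∀ v i → Adj v (nb v i)
      nb-injective : ∀ v → Injective _≡_ _≡_ (nb v)
      nb-complete  : ∀ {v w} → Adj v w → ∃[ i ] w ≡ nb v i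

  module _ {d : ℕ} (regular : Regular d) where
    open Regular regular

    -- Both lists of neighbours are free of duplicates and have the same members, hence are
    -- permutations of each other.
    degree≡ : ∀ v → degree v ≡ d
    degree≡ v = trans (↭-length (∼bag⇒↭ (unique∧set⇒bag
        (Unique.filter⁺ (adj? v) (Unique.allFin⁺ n))
        (Unique.tabulate⁺ (nb-injective v))
        (mk⇔ to from))))
      (length-tabulate (nb v))
      where
      to : ∀ {w} → w ∈ filter (adj? v) (allFin n) → w ∈ tabulate (nb v)
      to w∈ with nb-complete (proj₂ (∈-filter⁻ (adj? v) {xs = allFin n} w∈))
      ... | i , refl = ∈-tabulate⁺ i
      from : ∀ {w} → w ∈ tabulate (nb v) → w ∈ filter (adj? v) (allFin n)
      from w∈ with ∈-tabulate⁻ w∈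
      ... | i , refl = ∈-filter⁺ (adj? v) (∈-allFin _) (nb-adj v i)

    Δ≡ : Fin n → Δ ≡ d
    Δ≡ v = ≤-antisym
      (max≤v⁺ z≤n (All.map⁺ (All.tabulate⁺ (≤-reflexive ∘ degree≡))))
      (v≤max⁺ 0 _ (inj₂ (Any.map⁺ (Any.tabulate⁺ v (≤-reflexive (sym (degree≡ v)))))))

    -- The `d` edges at a vertex have distinct colours, so by pigeonhole one of them has colour `c`.
    -- Passing to its other end is an involution without fixed points.
    regular-colouring⇒2∣ : (colour : Edge → Fin d) → ProperColouring colour → Fin d → 2 ∣ n
    regular-colouring⇒2∣ colour proper c =
      fixpointFree-involution⇒2∣ (proj₁ ∘ mate) mate-mate mate≢
      where
      colour-determines-end : ∀ {e f u v w} → Joins e u v → Joins f u w → colour e ≡ colour f → v ≡ w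
      -- Distinct edges of one colour cannot meet at `u`, so `e` and `f` coincide.
      colour-determines-end {e} {f} {u} je jf eq = Joins-functional je (subst (λ g → Joins g u _)
        (sym (decidable-stable (e ≟ᵉ f) λ e≢f →
          proper e f e≢f eq (u , Joins⇒incident je , Joins⇒incident jf)))
        jf)

      incident : ∀ v i → ∃[ e ] Joins e v (nb v i)
      incident v i = join (nb-adj v i)

      colour-injective : ∀ v → Injective _≡_ _≡_ (colour ∘ proj₁ ∘ incident v)
      colour-injective v eq = nb-injective v
        (colour-determines-end (proj₂ (incident v _)) (proj₂ (incident v _)) eq)

      mate : ∀ v → ∃[ w ] ∃[ e ] Joins e v w × colour e ≡ c
      mate v with injective⇒surjective (colour-injective v) c
      ... | i , eq = nb v i , proj₁ (incident v i) , proj₂ (incident v i) , eq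

      mate-mate : ∀ v → proj₁ (mate (proj₁ (mate v))) ≡ v
      mate-mate v = matched (mate v) (mate (proj₁ (mate v)))
        where
        -- The two mates are generalised to arbitrary witnesses, which can be taken apart without
        -- unfolding `mate`.
        matched : ∀ {v} ((w , _) : ∃[ w ] ∃[ e ] Joins e v w × colour e ≡ c)
          ((u , _) : ∃[ u ] ∃[ e ] Joins e w u × colour e ≡ c) → u ≡ v
        matched (_ , _ , je , ce) (_ , _ , jf , cf) =
          colour-determines-end jf (Joins-sym je) (trans cf (sym ce))

      mate≢ : ∀ v → proj₁ (mate v) ≢ v
      mate≢ v eq = Joins-irrefl (subst (Joins _ v) eq (proj₁ (proj₂ (proj₂ (mate v)))))

    spareColouring-surjective : ¬ (2 ∣ n) → Fin d → (colour : Edge → Fin (suc d)) →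
      ProperColouring colour → Surjective _≡_ _≡_ colour
    spareColouring-surjective 2∤n c₀ colour proper c with anyEdge? (λ e → colour e Fin.≟ c)
    ... | yes (e , ce) = e , λ { refl → ce }
    ... | no miss = contradiction
      (regular-colouring⇒2∣ (λ e → punchOut (≢colour e))
        (λ e f e≢f eq → proper e f e≢f (Fin.punchOut-injective (≢colour e) (≢colour f) eq)) c₀)
      2∤n
      where
      ≢colour : ∀ e → c ≢ colour e
      ≢colour e eq = miss (e , sym eq)

  regular-nearlyDispersable : ∀ {d} → Regular (suc d) → ¬ (2 ∣ n) → Fin n →
    (π : CyclicOrder n) (colour : Edge → Fin (2 + d)) →
    (∀ e f → e ≢ f → colour e ≡ colour f → ¬ Cross G π e f × ¬ ShareEndpoint G e f) →
    NearlyDispersableWrt G π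
  regular-nearlyDispersable {d} regular 2∤n v π colour matching =
    ¬dispersable , subst (MatchingBookEmbedding G π ∘ suc) (sym (Δ≡ regular v)) record
      { colour   = colour
      ; allUsed  = spareColouring-surjective regular 2∤n zero colour
                     (λ e f e≢f eq → proj₂ (matching e f e≢f eq))
      ; matching = matching
      }
    where
    ¬dispersable : ¬ Dispersable G
    ¬dispersable (ρ , embedding) = 2∤n (regular-colouring⇒2∣ regular M.colour
        (λ e f e≢f eq → proj₂ (M.matching e f e≢f eq)) zero)
      where
      module M = MatchingBookEmbedding
        (subst (MatchingBookEmbedding G ρ) (Δ≡ regular v) embedding)

-- Disjoint chords.

-- For `a < b` and `c < d`: side by side or nested, with four distinct ends. This excludes a
-- crossing and a common endpoint at once.
data Apart (a b c d : ℕ) : Set where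
  before : b < c → Apart a b c d
  after  : d < a → Apart a b c d
  around : a < c → d < b → Apart a b c d
  within : c < a → b < d → Apart a b c d

Apart-sym : ∀ {a b c d} → Apart a b c d → Apart c d a b
Apart-sym (before b<c)     = after b<c
Apart-sym (after d<a)      = before d<a
Apart-sym (around a<c d<b) = within a<c d<b
Apart-sym (within c<a b<d) = around c<a b<d

-- The condition of `Cross` on four places alone, so that the ends of each chord can be swapped
-- freely.
Crossing : ∀ {n} → (a b c d : Fin n) → Set
Crossing a b c d = (Inside a b c × Outside a b d) ⊎ (Outside a b c × Inside a b d)

Inside-swap : ∀ {n} {a b x : Fin n} → Inside a b x → Inside b a x
Inside-swap = Sum.swap

Outside-swap : ∀ {n} {a b x : Fin n} → Outside a b x → Outside b a x
Outside-swap (inj₁ (p , q)) = inj₁ (q , p)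
Outside-swap (inj₂ (p , q)) = inj₂ (q , p)

Crossing-swapˡ : ∀ {n} {a b c d : Fin n} → Crossing a b c d → Crossing b a c d
Crossing-swapˡ = Sum.map (λ (i , o) → Inside-swap i , Outside-swap o)
                         (λ (o , i) → Outside-swap o , Inside-swap i)

Crossing-swapʳ : ∀ {n} {a b c d : Fin n} → Crossing a b c d → Crossing a b d c
Crossing-swapʳ (inj₁ (i , o)) = inj₂ (o , i)
Crossing-swapʳ (inj₂ (o , i)) = inj₁ (i , o)

module _ {n} {a b x : Fin n} (a<b : a <ᶠ b) where

  inside⁻ : Inside a b x → a <ᶠ x × x <ᶠ b
  inside⁻ (inj₁ a<x<b)       = a<x<b
  inside⁻ (inj₂ (b<x , x<a)) = contradiction (<-trans b<x x<a) (<-asym a<b)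

  outside⁻ : Outside a b x → x <ᶠ a ⊎ b <ᶠ x
  outside⁻ (inj₁ (x<a , _)) = inj₁ x<a
  outside⁻ (inj₂ (_ , b<x)) = inj₂ b<x

apart⇒¬crossing : ∀ {n} {a b c d : Fin n} → a <ᶠ b → c <ᶠ d →
  Apart (toℕ a) (toℕ b) (toℕ c) (toℕ d) → ¬ Crossing a b c d
apart⇒¬crossing {a = a} {b} {c} {d} a<b c<d = λ where
    (before b<c)     (inj₁ (i , _)) → <-asym b<c (proj₂ (inside⁻ a<b i))
    (before b<c)     (inj₂ (_ , i)) → <-asym (<-trans b<c c<d) (proj₂ (inside⁻ a<b i))
    (after d<a)      (inj₁ (i , _)) → <-asym (<-trans c<d d<a) (proj₁ (inside⁻ a<b i))
    (after d<a)      (inj₂ (_ , i)) → <-asym d<a (proj₁ (inside⁻ a<b i))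
    (around a<c d<b) (inj₁ (_ , o)) → not-outside (<-trans a<c c<d) d<b (outside⁻ a<b o)
    (around a<c d<b) (inj₂ (o , _)) → not-outside a<c (<-trans c<d d<b) (outside⁻ a<b o)
    (within c<a b<d) (inj₁ (i , _)) → <-asym c<a (proj₁ (inside⁻ a<b i))
    (within c<a b<d) (inj₂ (_ , i)) → <-asym b<d (proj₂ (inside⁻ a<b i))
  where
  not-outside : ∀ {x} → a <ᶠ x → x <ᶠ b → ¬ (x <ᶠ a ⊎ b <ᶠ x)
  not-outside a<x x<b (inj₁ x<a) = <-asym a<x x<a
  not-outside a<x x<b (inj₂ b<x) = <-asym x<b b<x

apart⇒disjoint : ∀ {a b c d x} → a < b → c < d → Apart a b c d →
  x ≡ a ⊎ x ≡ b → ¬ (x ≡ c ⊎ x ≡ d)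
apart⇒disjoint {a} {b} {c} {d} {x} a<b c<d = λ where
    (before b<c)     x∈ab x∈cd → <⇒≱ b<c (≤-trans (proj₁ (span c<d x∈cd)) (proj₂ (span a<b x∈ab)))
    (after d<a)      x∈ab x∈cd → <⇒≱ d<a (≤-trans (proj₁ (span a<b x∈ab)) (proj₂ (span c<d x∈cd)))
    (around a<c d<b) x∈ab x∈cd → strictly-inside a<c d<b (span c<d x∈cd) x∈ab
    (within c<a b<d) x∈ab x∈cd → strictly-inside c<a b<d (span a<b x∈ab) x∈cd
  where
  span : ∀ {p q y} → p < q → y ≡ p ⊎ y ≡ q → p ≤ y × y ≤ q
  span p<q (inj₁ refl) = ≤-refl , <⇒≤ p<q
  span p<q (inj₂ refl) = <⇒≤ p<q , ≤-refl

  strictly-inside : ∀ {p q s t y} → p < s → t < q → s ≤ y × y ≤ t → ¬ (y ≡ p ⊎ y ≡ q)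
  strictly-inside p<s _ (s≤y , _) (inj₁ refl) = <⇒≱ p<s s≤y
  strictly-inside _ t<q (_ , y≤t) (inj₂ refl) = <⇒≱ t<q y≤t

-- With equal sums, a later left end forces an earlier right end, so distinct chords are nested.
parallel-apart : ∀ {a b c d} → a + b ≡ c + d → (a ≡ c × b ≡ d) ⊎ Apart a b c d
parallel-apart {a} {b} {c} {d} eq with <-cmp a c
... | tri< a<c _ _  = inj₂ (around a<c (+-cancelˡ-< a d b
        (<-≤-trans (+-monoˡ-< d a<c) (≤-reflexive (sym eq)))))
... | tri≈ _ refl _ = inj₁ (refl , +-cancelˡ-≡ a b d eq)
... | tri> _ _ c<a  = inj₂ (within c<a (+-cancelˡ-< c b d
        (<-≤-trans (+-monoˡ-< b c<a) (≤-reflexive eq))))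

-- Starts of equal parity are at least 2 apart, which leaves room for a chord to the next place. The
-- offset `s` is 1 on page `2F` and 0 on page `4F`.
2*-gap : ∀ s {h k} → h < k → 1 + (s + 2 * h) < s + 2 * k
2*-gap s {h} {k} h<k = begin
  2 + (s + 2 * h)    ≡⟨ shift s h ⟩
  s + 2 * suc h      ≤⟨ +-monoʳ-≤ s (*-monoʳ-≤ 2 h<k) ⟩
  s + 2 * k          ∎
  where
  open ≤-Reasoning
  shift : ∀ s h → 2 + (s + 2 * h) ≡ s + 2 * suc h
  shift = solve-∀

-- The five pages.

module _ (r : ℕ) where

  -- Page k p q: the chord between the places p < q is drawn on page k; here m = 3 + r.
  -- C₁, C₂, E₂ and E₃ leave out the neighbouring places p = 0, m - 1, m, m + 1, where
  -- B₀, A, no edge at all, and D₁ are found instead.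
  data Page : Fin 5 → ℕ → ℕ → Set where
    A  : ∀ {p q} → p < q → p + q ≡ 5 + 2 * r → Page 0F p q
    B₀ : Page 1F 0 1
    B₁ : ∀ {p q} → 2 ≤ p → p < q → p + q ≡ 8 + 2 * r → Page 1F p q
    C₀ : Page 2F 0 (4 + r)
    C₁ : ∀ h → 1 + 2 * h ≤ 1 + r → Page 2F (1 + 2 * h) (2 + 2 * h)
    C₂ : ∀ h → 5 + r ≤ 1 + 2 * h → Page 2F (1 + 2 * h) (2 + 2 * h)
    D₀ : Page 3F 0 (2 + r)
    D₁ : Page 3F (4 + r) (5 + r)
    D₂ : Page 3F (3 + r) (6 + 2 * r)
    E₀ : Page 4F 1 (3 + r)
    E₁ : Page 4F (4 + r) (6 + 2 * r)
    E₂ : ∀ h → 2 ≤ 2 * h → 2 * h ≤ 1 + r → Page 4F (2 * h) (1 + 2 * h)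
    E₃ : ∀ h → 5 + r ≤ 2 * h → 2 * h < 5 + 2 * r → Page 4F (2 * h) (1 + 2 * h)

  3+r<6+2r : 3 + r < 6 + 2 * r
  3+r<6+2r = s≤s (s≤s (s≤s (s≤s (≤-trans (m≤n*m r 2) (m≤n+m (2 * r) 2)))))

  4+r<6+2r : 4 + r < 6 + 2 * r
  4+r<6+2r = s≤s (s≤s (s≤s (s≤s (s≤s (≤-trans (m≤n*m r 2) (m≤n+m (2 * r) 1))))))

  5+r<6+2r : 5 + r < 6 + 2 * r
  5+r<6+2r = s≤s (s≤s (s≤s (s≤s (s≤s (s≤s (m≤n*m r 2))))))

  Page⇒< : ∀ {k p q} → Page k p q → p < q
  Page⇒< (A p<q _)    = p<q
  Page⇒< B₀           = s≤s z≤n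
  Page⇒< (B₁ _ p<q _) = p<q
  Page⇒< C₀           = s≤s z≤n
  Page⇒< (C₁ h _)     = ≤-refl
  Page⇒< (C₂ h _)     = ≤-refl
  Page⇒< D₀           = s≤s z≤n
  Page⇒< D₁           = ≤-refl
  Page⇒< D₂           = 3+r<6+2r
  Page⇒< E₀           = s≤s (s≤s z≤n)
  Page⇒< E₁           = 4+r<6+2r
  Page⇒< (E₂ h _ _)   = ≤-refl
  Page⇒< (E₃ h _ _)   = ≤-refl

  SameOrApart : ℕ → ℕ → ℕ → ℕ → Set
  SameOrApart a b c d = (a ≡ c × b ≡ d) ⊎ Apart a b c d

  neighbours-apart : ∀ s h k → SameOrApart (s + 2 * h) (1 + (s + 2 * h)) (s + 2 * k) (1 + (s + 2 * k))
  neighbours-apart s h k with <-cmp h k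
  ... | tri< h<k _ _  = inj₂ (before (2*-gap s h<k))
  ... | tri≈ _ refl _ = inj₁ (refl , refl)
  ... | tri> _ _ k<h  = inj₂ (after (2*-gap s k<h))

  -- Chords of `A`, and those of `B₁`, have equal sums, and `B₀` ends before place 2. Short chords
  -- on pages `2F` and `4F` have starts of equal parity, and their bounds keep them strictly inside
  -- or outside the long chords `C₀`, `E₀` and `E₁`. Page `3F` has just three chords.
  separate : ∀ {k p q p′ q′} → Page k p q → Page k p′ q′ → SameOrApart p q p′ q′
  separate (A _ eq)      (A _ eq′)     = parallel-apart (trans eq (sym eq′))
  separate B₀            B₀            = inj₁ (refl , refl)
  separate B₀            (B₁ 2≤p _ _)  = inj₂ (before 2≤p)
  separate (B₁ 2≤p _ _)  B₀            = inj₂ (after 2≤p)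
  separate (B₁ _ _ eq)   (B₁ _ _ eq′)  = parallel-apart (trans eq (sym eq′))
  separate C₀            C₀            = inj₁ (refl , refl)
  separate C₀            (C₁ _ hi)     = inj₂ (around (s≤s z≤n) (s≤s (s≤s (m≤n⇒m≤1+n hi))))
  separate C₀            (C₂ _ lo)     = inj₂ (before lo)
  separate (C₁ _ hi)     C₀            = inj₂ (within (s≤s z≤n) (s≤s (s≤s (m≤n⇒m≤1+n hi))))
  separate (C₁ h _)      (C₁ k _)      = neighbours-apart 1 h k
  separate (C₁ h _)      (C₂ k _)      = neighbours-apart 1 h k
  separate (C₂ _ lo)     C₀            = inj₂ (after lo)
  separate (C₂ h _)      (C₁ k _)      = neighbours-apart 1 h k
  separate (C₂ h _)      (C₂ k _)      = neighbours-apart 1 h k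
  separate D₀            D₀            = inj₁ (refl , refl)
  separate D₀            D₁            = inj₂ (before (s≤s (s≤s (s≤s (n≤1+n r)))))
  separate D₀            D₂            = inj₂ (before ≤-refl)
  separate D₁            D₀            = inj₂ (after (s≤s (s≤s (s≤s (n≤1+n r)))))
  separate D₁            D₁            = inj₁ (refl , refl)
  separate D₁            D₂            = inj₂ (within ≤-refl 5+r<6+2r)
  separate D₂            D₀            = inj₂ (after ≤-refl)
  separate D₂            D₁            = inj₂ (around ≤-refl 5+r<6+2r)
  separate D₂            D₂            = inj₁ (refl , refl)
  separate E₀            E₀            = inj₁ (refl , refl)
  separate E₀            E₁            = inj₂ (before ≤-refl)
  separate E₀            (E₂ _ lo hi)  = inj₂ (around lo (s≤s (s≤s hi)))
  separate E₀            (E₃ _ lo _)   = inj₂ (before (<⇒≤ lo))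
  separate E₁            E₀            = inj₂ (after ≤-refl)
  separate E₁            E₁            = inj₁ (refl , refl)
  separate E₁            (E₂ _ _ hi)   = inj₂ (after (s≤s (s≤s (m≤n⇒m≤1+n hi))))
  separate E₁            (E₃ _ lo hi)  = inj₂ (around lo (s≤s hi))
  separate (E₂ _ lo hi)  E₀            = inj₂ (within lo (s≤s (s≤s hi)))
  separate (E₂ _ _ hi)   E₁            = inj₂ (before (s≤s (s≤s (m≤n⇒m≤1+n hi))))
  separate (E₂ h _ _)    (E₂ k _ _)    = neighbours-apart 0 h k
  separate (E₂ h _ _)    (E₃ k _ _)    = neighbours-apart 0 h k
  separate (E₃ _ lo _)   E₀            = inj₂ (after (<⇒≤ lo))
  separate (E₃ _ lo hi)  E₁            = inj₂ (within lo (s≤s hi))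
  separate (E₃ h _ _)    (E₂ k _ _)    = neighbours-apart 0 h k
  separate (E₃ h _ _)    (E₃ k _ _)    = neighbours-apart 0 h k

  -- `Page` wants the smaller place first, but the source of an edge may be placed after its target;
  -- hence both orientations.
  Drawn : ℕ → ℕ → Set
  Drawn a b = ∃[ k ] (Page k a b ⊎ Page k b a)

  Drawn-sym : ∀ {a b} → Drawn a b → Drawn b a
  Drawn-sym (k , page) = k , Sum.swap page

  pages-separate : ∀ {n k} {a b c d : Fin n} → Page k (toℕ a) (toℕ b) → Page k (toℕ c) (toℕ d) →
    (a ≡ c × b ≡ d) ⊎ (¬ Crossing a b c d × (∀ {x} → x ≡ a ⊎ x ≡ b → ¬ (x ≡ c ⊎ x ≡ d)))
  pages-separate P Q with separate P Q
  ... | inj₁ (p , q) = inj₁ (Fin.toℕ-injective p , Fin.toℕ-injective q)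
  ... | inj₂ apart   = inj₂ (apart⇒¬crossing (Page⇒< P) (Page⇒< Q) apart , λ x∈ab x∈cd →
          apart⇒disjoint (Page⇒< P) (Page⇒< Q) apart
            (Sum.map (cong toℕ) (cong toℕ) x∈ab) (Sum.map (cong toℕ) (cong toℕ) x∈cd))

  -- Turning chords round reduces all cases to `pages-separate`; chords read in opposite
  -- orientations may coincide with their ends interchanged.
  drawn-separate : ∀ {n} {a b c d : Fin n}
    ((k , _) : Drawn (toℕ a) (toℕ b)) ((l , _) : Drawn (toℕ c) (toℕ d)) → k ≡ l →
    ((a ≡ c × b ≡ d) ⊎ (a ≡ d × b ≡ c)) ⊎
    (¬ Crossing a b c d × (∀ {x} → x ≡ a ⊎ x ≡ b → ¬ (x ≡ c ⊎ x ≡ d)))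
  drawn-separate (_ , inj₁ P) (_ , inj₁ Q) refl =
    Sum.map inj₁ id (pages-separate P Q)
  drawn-separate (_ , inj₁ P) (_ , inj₂ Q) refl =
    Sum.map inj₂ (λ (¬x , ¬s) → ¬x ∘ Crossing-swapʳ , λ p q → ¬s p (Sum.swap q)) (pages-separate P Q)
  drawn-separate (_ , inj₂ P) (_ , inj₁ Q) refl =
    Sum.map (inj₂ ∘ swap) (λ (¬x , ¬s) → ¬x ∘ Crossing-swapˡ , λ p → ¬s (Sum.swap p)) (pages-separate P Q)
  drawn-separate (_ , inj₂ P) (_ , inj₂ Q) refl =
    Sum.map (inj₁ ∘ swap)
      (λ (¬x , ¬s) → ¬x ∘ Crossing-swapˡ ∘ Crossing-swapʳ , λ p q → ¬s (Sum.swap p) (Sum.swap q))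
      (pages-separate P Q)

  -- From edges to pages.

  N : ℕ
  N = 7 + 2 * r

  N≡ : N ≡ 1 + 2 * (3 + r)
  N≡ = cong suc (sym (*-distribˡ-+ 2 3 r))

  even<N : ∀ {h} → 2 * h < N → h ≤ 3 + r
  even<N {h} lt = *-cancelˡ-≤ 2 (s≤s⁻¹ (subst (2 * h <_) N≡ lt))

  odd<N : ∀ {h} → 1 + 2 * h < N → h ≤ 2 + r
  odd<N {h} lt = s≤s⁻¹ (*-cancelˡ-< 2 h (3 + r) (s≤s⁻¹ (subst (1 + 2 * h <_) N≡ lt)))

  -- The place is specified by a sum equal to 2 m, which avoids truncated subtraction in what
  -- follows.
  place-odd : ∀ {q} h → q + h ≡ 6 + 2 * r → zigzag⁻¹ N (1 + 2 * h) ≡ q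
  place-odd {q} h eq = begin
    zigzag⁻¹ N (1 + 2 * h)    ≡⟨ zigzag⁻¹-odd N h ⟩
    6 + 2 * r ∸ h             ≡⟨ cong (_∸ h) eq ⟨
    q + h ∸ h                 ≡⟨ m+n∸n≡m q h ⟩
    q                         ∎
    where open ≡-Reasoning

  odd-place : ∀ {h} → h ≤ 3 + r → ∃[ q ] q + h ≡ 6 + 2 * r
  odd-place {h} h≤ = 6 + 2 * r ∸ h , m∸n+n≡m (≤-trans h≤ (<⇒≤ 3+r<6+2r))

  4+r+2+r≡6+2r : 4 + r + (2 + r) ≡ 6 + 2 * r
  4+r+2+r≡6+2r = lemma r
    where
    lemma : ∀ r → 4 + r + (2 + r) ≡ 6 + 2 * r
    lemma = solve-∀

  -- Odd vertices, counted from 0, occur in decreasing order; `y` is the place of vertex 1 + 2 x.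
  odd-place-≥ : ∀ {q h} y x → q + h ≡ 6 + 2 * r → y + x ≡ 6 + 2 * r → h ≤ x → y ≤ q
  odd-place-≥ {q} {h} y x qh yx h≤x = +-cancelʳ-≤ x y q (begin
    y + x        ≡⟨ trans yx (sym qh) ⟩
    q + h        ≤⟨ +-monoʳ-≤ q h≤x ⟩
    q + x        ∎)
    where open ≤-Reasoning

  drawn-top : ∀ h → h ≤ 2 + r → Drawn h (suc h)
  drawn-top h h≤2+r with h ≟ 2 + r
  -- The chord from m - 1 to m has place sum 2 m - 1, that of page `0F`.
  ... | yes refl = 0F , inj₁ (A ≤-refl (sum r))
    where
    sum : ∀ r → 2 + r + (3 + r) ≡ 5 + 2 * r
    sum = solve-∀
  ... | no h≢2+r with s≤s⁻¹ (≤∧≢⇒< h≤2+r h≢2+r) | evenOrOdd h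
  ...   | _     | even 0       = 1F , inj₁ B₀
  ...   | h≤1+r | even (suc g) = 4F , inj₁ (E₂ (suc g) (m≤m*n 2 (suc g)) h≤1+r)
  ...   | h≤1+r | odd g        = 2F , inj₁ (C₁ g h≤1+r)

  drawn-bottom : ∀ p → 4 + r ≤ p → p < 6 + 2 * r → Drawn p (suc p)
  drawn-bottom p 4+r≤p p<6+2r with p ≟ 4 + r
  ... | yes refl = 3F , inj₁ D₁
  ... | no p≢4+r with ≤∧≢⇒< 4+r≤p (p≢4+r ∘ sym) | evenOrOdd p
  ...   | 5+r≤p | odd g  = 2F , inj₁ (C₂ g 5+r≤p)
  -- A chord starting at 5 + 2 r would share an end with `E₁`; its start is odd, so it falls under
  -- `C₂` instead.
  ...   | 5+r≤p | even g = 4F , inj₁ (E₃ g 5+r≤p (≤∧≢⇒< (s≤s⁻¹ p<6+2r) p≢5+2r))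
    where
    5+2r-odd : 5 + 2 * r ≡ suc (2 * (2 + r))
    5+2r-odd = cong suc (sym (*-distribˡ-+ 2 2 r))
    p≢5+2r : 2 * g ≢ 5 + 2 * r
    p≢5+2r eq = even≢odd g (2 + r) (trans eq 5+2r-odd)

  data DrawnVertices (u v : ℕ) : Set where
    at : ∀ {p q} → zigzag⁻¹ N u ≡ p → zigzag⁻¹ N v ≡ q → Drawn p q → DrawnVertices u v

  drawn-2 : ∀ u → u + 2 < N → DrawnVertices u (u + 2)
  drawn-2 u u+2<N rewrite +-comm u 2 with evenOrOdd u
  ... | even h = subst (λ v → v < N → DrawnVertices (2 * h) v) (*-suc 2 h)
        (λ v<N → at (zigzag⁻¹-even N h) (zigzag⁻¹-even N (suc h)) (drawn-top h (s≤s⁻¹ (even<N v<N))))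
        u+2<N
  ... | odd h = subst (λ v → 1 + v < N → DrawnVertices (1 + 2 * h) (1 + v)) (*-suc 2 h)
        wide u+2<N
    where
    wide : 1 + 2 * suc h < N → DrawnVertices (1 + 2 * h) (1 + 2 * suc h)
    wide v<N with odd<N v<N
    ... | h<2+r with odd-place (m≤n⇒m≤1+n h<2+r)
    -- Vertex 1 + 2 h sits at q + 1 and its successor on the path at q: this path runs backwards,
    -- hence `Drawn-sym`.
    ...   | q , q+1+h = at (place-odd h (trans (sym (+-suc q h)) q+1+h)) (place-odd (suc h) q+1+h)
            (Drawn-sym (drawn-bottom q (odd-place-≥ (4 + r) (2 + r) q+1+h 4+r+2+r≡6+2r h<2+r)
              (m+n≤o⇒m≤o (suc q) (≤-reflexive (trans (sym (+-suc q h)) q+1+h)))))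

  drawn-3 : ∀ u → u + 3 < N → DrawnVertices u (u + 3)
  drawn-3 u u+3<N rewrite +-comm u 3 with evenOrOdd u
  ... | even h = subst (λ v → 1 + v < N → DrawnVertices (2 * h) (1 + v)) (*-suc 2 h) wide u+3<N
    where
    wide : 1 + 2 * suc h < N → DrawnVertices (2 * h) (1 + 2 * suc h)
    wide v<N with odd<N v<N
    ... | h<2+r with odd-place (m≤n⇒m≤1+n h<2+r)
    -- Here h < m - 1 and q is at least m + 1, and h + q = 2 m - 1.
    ...   | q , q+1+h = at (zigzag⁻¹-even N h) (place-odd (suc h) q+1+h) (0F , inj₁ (A
            (<-≤-trans h<2+r (≤-trans (m≤n+m (2 + r) 2) (odd-place-≥ (4 + r) (2 + r) q+1+h 4+r+2+r≡6+2r h<2+r)))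
            (suc-injective (trans (cong suc (+-comm h q)) (trans (sym (+-suc q h)) q+1+h)))))
  ... | odd h = subst (λ v → v < N → DrawnVertices (1 + 2 * h) v) (*-distribˡ-+ 2 2 h) wide u+3<N
    where
    sum : ∀ r → 5 + r + (1 + r) ≡ 6 + 2 * r
    sum = solve-∀
    wide : 2 * (2 + h) < N → DrawnVertices (1 + 2 * h) (2 * (2 + h))
    wide v<N with s≤s⁻¹ (s≤s⁻¹ (even<N v<N))
    ... | h≤1+r with odd-place (m≤n⇒m≤1+n (m≤n⇒m≤1+n h≤1+r))
    -- The target has the smaller place 2 + h, hence `inj₂`; the sum is 2 m + 2.
    ...   | q , q+h = at (place-odd h q+h) (zigzag⁻¹-even N (2 + h)) (1F , inj₂ (B₁
            (m≤m+n 2 h)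
            (≤-trans (s≤s (s≤s (s≤s h≤1+r))) (≤-trans (n≤1+n _) (odd-place-≥ (5 + r) (1 + r) q+h (sum r) h≤1+r)))
            (cong (2 +_) (trans (+-comm h q) q+h))))

  place-1 : zigzag⁻¹ N 1 ≡ 6 + 2 * r
  place-1 = place-odd 0 (+-identityʳ _)

  place-4+2r : zigzag⁻¹ N (4 + 2 * r) ≡ 2 + r
  place-4+2r = trans (cong (zigzag⁻¹ N) (sym (*-distribˡ-+ 2 2 r))) (zigzag⁻¹-even N (2 + r))

  place-5+2r : zigzag⁻¹ N (5 + 2 * r) ≡ 4 + r
  place-5+2r = trans (cong (zigzag⁻¹ N ∘ suc) (sym (*-distribˡ-+ 2 2 r))) (place-odd (2 + r) 4+r+2+r≡6+2r)

  place-6+2r : zigzag⁻¹ N (6 + 2 * r) ≡ 3 + r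
  place-6+2r = trans (cong (zigzag⁻¹ N) (sym (*-distribˡ-+ 2 3 r))) (zigzag⁻¹-even N (3 + r))

  -- Adding N - 3 amounts to a jump by -3. Only u = 0, 1, 2 leave room for it below N: three of the
  -- five edges that wrap around.
  drawn-[-3] : ∀ u → u + (4 + 2 * r) < N → DrawnVertices u (u + (4 + 2 * r))
  drawn-[-3] u lt with u | +-cancelʳ-< (4 + 2 * r) u 3 lt
  ... | 0 | _ = at refl place-4+2r (3F , inj₁ D₀)
  ... | 1 | _ = at place-1 place-5+2r (4F , inj₂ E₁)
  ... | 2 | _ = at refl place-6+2r (4F , inj₁ E₀)
  ... | suc (suc (suc _)) | s≤s (s≤s (s≤s ()))

  -- The other two edges that wrap around, from u = 0 and u = 1.
  drawn-[-2] : ∀ u → u + (5 + 2 * r) < N → DrawnVertices u (u + (5 + 2 * r))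
  drawn-[-2] u lt with u | +-cancelʳ-< (5 + 2 * r) u 2 lt
  ... | 0 | _ = at refl place-5+2r (2F , inj₁ C₀)
  ... | 1 | _ = at place-1 place-6+2r (3F , inj₂ D₂)
  ... | suc (suc _) | s≤s (s≤s ())

-- Residues modulo n.

module _ {n : ℕ} .{{_ : NonZero n}} where

  %-congʳ-+ : ∀ x y z → x % n ≡ y % n → (x + z) % n ≡ (y + z) % n
  %-congʳ-+ x y z eq = begin
    (x + z) % n            ≡⟨ %-distribˡ-+ x z n ⟩
    (x % n + z % n) % n    ≡⟨ cong (λ t → (t + z % n) % n) eq ⟩
    (y % n + z % n) % n    ≡⟨ %-distribˡ-+ y z n ⟨
    (y + z) % n            ∎
    where open ≡-Reasoning

  %-cong-suc : ∀ x y → x % n ≡ y % n → suc x % n ≡ suc y % n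
  %-cong-suc x y eq = begin
    suc x % n      ≡⟨ cong (_% n) (+-comm 1 x) ⟩
    (x + 1) % n    ≡⟨ %-congʳ-+ x y 1 eq ⟩
    (y + 1) % n    ≡⟨ cong (_% n) (+-comm y 1) ⟩
    suc y % n      ∎
    where open ≡-Reasoning

  -- Subtracting `z` is adding its complement `n ∸ z`.
  %-cancelʳ-+ : ∀ x y {z} → z ≤ n → (x + z) % n ≡ (y + z) % n → x % n ≡ y % n
  %-cancelʳ-+ x y {z} le eq = begin
    x % n                       ≡⟨ around-n x ⟨
    (x + z + (n ∸ z)) % n       ≡⟨ %-congʳ-+ (x + z) (y + z) (n ∸ z) eq ⟩
    (y + z + (n ∸ z)) % n       ≡⟨ around-n y ⟩
    y % n                       ∎
    where
    open ≡-Reasoning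
    around-n : ∀ t → (t + z + (n ∸ z)) % n ≡ t % n
    around-n t = trans (cong (_% n) (trans (+-assoc t z (n ∸ z)) (cong (t +_) (m+[n∸m]≡n le))))
                       ([m+n]%n≡m%n t n)

  %-cancelˡ-+ : ∀ x y {z} → z ≤ n → (z + x) % n ≡ (z + y) % n → x % n ≡ y % n
  %-cancelˡ-+ x y {z} le eq = %-cancelʳ-+ x y le
    (trans (cong (_% n) (+-comm x z)) (trans eq (cong (_% n) (+-comm z y))))

  %-injective : ∀ {x y} → x < n → y < n → x % n ≡ y % n → x ≡ y
  %-injective x<n y<n eq = trans (sym (m<n⇒m%n≡m x<n)) (trans eq (m<n⇒m%n≡m y<n))

  -- Both `c` and `v ∸ u` lie below `n` and are congruent, hence equal.
  +%-no-wrap : ∀ {u v c} → u < v → v < n → c < n → (u + c) % n ≡ v % n → u + c ≡ v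
  +%-no-wrap {u} {v} {c} u<v v<n c<n eq = trans (cong (u +_) c≡v∸u) u+[v∸u]
    where
    u+[v∸u] = m+[n∸m]≡n (<⇒≤ u<v)
    c≡v∸u : c ≡ v ∸ u
    c≡v∸u = %-injective c<n (≤-<-trans (m∸n≤m v u) v<n)
      (%-cancelˡ-+ c (v ∸ u) (<⇒≤ (<-trans u<v v<n)) (trans eq (cong (_% n) (sym u+[v∸u]))))

  -- `c` is the negative of `s` modulo n.
  %-reverse : ∀ x y {s c} → s + c ≡ n → (x + s) % n ≡ y % n → (y + c) % n ≡ x % n
  %-reverse x y {s} {c} s+c≡n eq = begin
    (y + c) % n        ≡⟨ %-congʳ-+ (x + s) y c eq ⟨
    (x + s + c) % n    ≡⟨ cong (_% n) (trans (+-assoc x s c) (cong (x +_) s+c≡n)) ⟩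
    (x + n) % n        ≡⟨ [m+n]%n≡m%n x n ⟩
    x % n              ∎
    where open ≡-Reasoning

-- The circulant and its colouring.

place-injective : ∀ {n} (π : CyclicOrder n) {u v} → place π u ≡ place π v → u ≡ v
place-injective π eq = trans (sym (inverseʳ π)) (trans (cong (π ⟨$⟩ʳ_) eq) (inverseʳ π))

module _ (k : ℕ) where

  -- The jumps 2, 3, -3, -2 as residues modulo 7 + k.
  jump : Fin 4 → ℕ
  jump 0F = 2
  jump 1F = 3
  jump 2F = 4 + k
  jump 3F = 5 + k

  jump< : ∀ i → jump i < 7 + k
  jump< 0F = s≤s (s≤s (s≤s z≤n))
  jump< 1F = s≤s (s≤s (s≤s (s≤s z≤n)))
  jump< 2F = m≤n+m (5 + k) 2
  jump< 3F = m≤n+m (6 + k) 1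

  jump-injective : ∀ {i j} → jump i ≡ jump j → i ≡ j
  jump-injective {0F} {0F} _  = refl
  jump-injective {0F} {1F} ()
  jump-injective {0F} {2F} ()
  jump-injective {0F} {3F} ()
  jump-injective {1F} {1F} _  = refl
  jump-injective {1F} {2F} ()
  jump-injective {1F} {3F} ()
  jump-injective {2F} {2F} _  = refl
  jump-injective {2F} {3F} eq = contradiction (sym eq) 1+n≢n
  jump-injective {3F} {2F} eq = contradiction eq 1+n≢n
  jump-injective {3F} {3F} _  = refl

-- The equations are hypotheses so that matching on them turns `n` into `N r`.
drawn-jump : ∀ r {k n} → k ≡ 2 * r → 7 + k ≡ n → ∀ u v i → u + jump k i ≡ v → v < n →
  Drawn r (zigzag⁻¹ n u) (zigzag⁻¹ n v)
drawn-jump r refl refl u v i refl v<n = drawnPlaces (by-jump i v<n)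
  where
  by-jump : ∀ i → u + jump (2 * r) i < 7 + 2 * r → DrawnVertices r u (u + jump (2 * r) i)
  by-jump 0F = drawn-2 r u
  by-jump 1F = drawn-3 r u
  by-jump 2F = drawn-[-3] r u
  by-jump 3F = drawn-[-2] r u
  drawnPlaces : ∀ {u v} → DrawnVertices r u v → Drawn r (zigzag⁻¹ (N r) u) (zigzag⁻¹ (N r) v)
  drawnPlaces (at refl refl d) = d

module _ {n : ℕ} (n≥7 : n ≥ 7) (k : ℕ) (7+k≡n : 7 + k ≡ n) where

  private
    instance
      n≢0 : NonZero n
      n≢0 = >-nonZero (≤-trans (s≤s z≤n) n≥7)

    G : Graph n
    G = circulant n (2 ∷ 3 ∷ []) (isJumpSet-2,3 n≥7)

  open Graph G
  open Edge

  jump<n : ∀ i → jump k i < n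
  jump<n i = subst (jump k i <_) 7+k≡n (jump< k i)

  -- `Step` compares labels, which start at 1; this common 1 cancels.
  Step⁻ : ∀ s (u v : Fin n) → Step s u v → (toℕ u + s) % n ≡ toℕ v % n
  Step⁻ s u v = %-cancelˡ-+ (toℕ u + s) (toℕ v) {1} (>-nonZero⁻¹ n)

  Step⁺ : ∀ s (u v : Fin n) → (toℕ u + s) % n ≡ toℕ v % n → Step s u v
  Step⁺ s u v = %-cong-suc {{n≢0}} (toℕ u + s) (toℕ v)

  adj⇒jump : ∀ u v → Adj u v → ∃[ i ] (toℕ u + jump k i) % n ≡ toℕ v % n
  adj⇒jump u v (here (inj₁ step))         = 0F , Step⁻ 2 u v step
  adj⇒jump u v (there (here (inj₁ step))) = 1F , Step⁻ 3 u v step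
  adj⇒jump u v (there (here (inj₂ step))) = 2F , %-reverse (toℕ v) (toℕ u) {3} 7+k≡n (Step⁻ 3 v u step)
  adj⇒jump u v (here (inj₂ step))         = 3F , %-reverse (toℕ v) (toℕ u) {2} 7+k≡n (Step⁻ 2 v u step)

  jump⇒adj : ∀ u v i → (toℕ u + jump k i) % n ≡ toℕ v % n → Adj u v
  jump⇒adj u v 0F eq = here (inj₁ (Step⁺ 2 u v eq))
  jump⇒adj u v 1F eq = there (here (inj₁ (Step⁺ 3 u v eq)))
  jump⇒adj u v 2F eq = there (here (inj₂ (Step⁺ 3 v u (%-reverse (toℕ u) (toℕ v) (trans (+-comm (4 + k) 3) 7+k≡n) eq))))
  jump⇒adj u v 3F eq = here (inj₂ (Step⁺ 2 v u (%-reverse (toℕ u) (toℕ v) (trans (+-comm (5 + k) 2) 7+k≡n) eq)))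

  regular : Regular G 4
  regular = record
    { nb           = nb
    ; nb-adj       = λ v i → jump⇒adj v (nb v i) i (sym (toℕ-nb-% v i))
    ; nb-injective = λ v {i} {j} eq → jump-injective k (%-injective (jump<n i) (jump<n j)
        (%-cancelˡ-+ (jump k i) (jump k j) (<⇒≤ (Fin.toℕ<n v))
          (trans (sym (toℕ-nb v i)) (trans (cong toℕ eq) (toℕ-nb v j)))))
    ; nb-complete  = λ {v} {w} v~w → let i , eq = adj⇒jump v w v~w in
        i , Fin.toℕ-injective (trans (sym (m<n⇒m%n≡m (Fin.toℕ<n w))) (trans (sym eq) (sym (toℕ-nb v i))))
    }
    where
    nb : Fin n → Fin 4 → Fin n
    nb v i = (toℕ v + jump k i) mod n
    toℕ-nb : ∀ v i → toℕ (nb v i) ≡ (toℕ v + jump k i) % n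
    toℕ-nb v i = Fin.toℕ-fromℕ< _
    toℕ-nb-% : ∀ v i → toℕ (nb v i) % n ≡ (toℕ v + jump k i) % n
    toℕ-nb-% v i = trans (cong (_% n) (toℕ-nb v i)) (m%n%n≡m%n (toℕ v + jump k i) n)

  module _ (r : ℕ) (k≡2r : k ≡ 2 * r) where

    toℕ-place : ∀ v → toℕ (place (ω n) v) ≡ zigzag⁻¹ n (toℕ v)
    toℕ-place v = Fin.toℕ-fromℕ< _

    DrawnPlaces : Fin n → Fin n → Set
    DrawnPlaces u v = Drawn r (toℕ (place (ω n) u)) (toℕ (place (ω n) v))

    drawn : ∀ {u v} → u <ᶠ v → Adj u v → DrawnPlaces u v
    drawn {u} {v} u<v u~v = let i , eq = adj⇒jump u v u~v in
      subst₂ (Drawn r) (sym (toℕ-place u)) (sym (toℕ-place v))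
        (drawn-jump r k≡2r 7+k≡n (toℕ u) (toℕ v) i
          (+%-no-wrap u<v (Fin.toℕ<n v) (jump<n i) eq) (Fin.toℕ<n v))

    -- Only the type of the drawing matters from here on, so its computation is hidden.
    abstract
      drawnEdge : (e : Edge) → DrawnPlaces (src e) (tgt e)
      drawnEdge (edge u v u<v u~v) = drawn (recompute (u Fin.<? v) u<v) (recompute (adj? u v) u~v)

    page : Edge → Fin 5
    page e = proj₁ (drawnEdge e)

    edge-≡ : ∀ {e f} → src e ≡ src f → tgt e ≡ tgt f → e ≡ f
    edge-≡ refl refl = refl

    -- Both edges store the smaller end first. This rules out the coincidence with interchanged ends
    -- left open by `drawn-separate`.
    not-reversed : ∀ {e f} → src e ≡ tgt f → tgt e ≢ src f
    not-reversed {edge u v u<v _} {edge _ _ v<u _} refl refl =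
      contradiction-irr v<u (<-asym (recompute (u Fin.<? v) u<v))

    page-matching : ∀ e f → e ≢ f → page e ≡ page f → ¬ Cross G (ω n) e f × ¬ ShareEndpoint G e f
    page-matching e f e≢f eq = conclude (drawn-separate r (drawnEdge e) (drawnEdge f) eq)
      where
      p : Fin n → Fin n
      p = place (ω n)
      conclude : ((p (src e) ≡ p (src f) × p (tgt e) ≡ p (tgt f)) ⊎ (p (src e) ≡ p (tgt f) × p (tgt e) ≡ p (src f))) ⊎
        (¬ Crossing (p (src e)) (p (tgt e)) (p (src f)) (p (tgt f)) ×
          (∀ {x} → x ≡ p (src e) ⊎ x ≡ p (tgt e) → ¬ (x ≡ p (src f) ⊎ x ≡ p (tgt f)))) →
        ¬ Cross G (ω n) e f × ¬ ShareEndpoint G e f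
      conclude (inj₁ (inj₁ (s , t))) =
        contradiction (edge-≡ (place-injective (ω n) s) (place-injective (ω n) t)) e≢f
      conclude (inj₁ (inj₂ (s , t))) =
        contradiction (place-injective (ω n) t) (not-reversed {e} {f} (place-injective (ω n) s))
      conclude (inj₂ (¬cross , disjoint)) = ¬cross , λ (v , v∈e , v∈f) →
        disjoint (Sum.map (cong p) (cong p) v∈e) (Sum.map (cong p) (cong p) v∈f)

    nearlyDispersable : ¬ (2 ∣ n) → NearlyDispersableWrt G (ω n)
    nearlyDispersable 2∤n =
      regular-nearlyDispersable G regular 2∤n (fromℕ< (≤-trans (s≤s z≤n) n≥7)) (ω n) page page-matching

odd⇒∃r : ∀ {k n} → 7 + k ≡ n → ¬ (2 ∣ n) → ∃[ r ] k ≡ 2 * r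
odd⇒∃r {k} refl 2∤n with evenOrOdd k
... | even r = r , refl
... | odd h  = contradiction
  -- For k = 1 + 2 h the order 7 + k is 2 (4 + h).
  (divides (4 + h) (trans (sym (*-distribˡ-+ 2 4 h)) (*-comm 2 (4 + h)))) 2∤n

theorem5 : (n : ℕ) (n≥7 : n ≥ 7) → ¬ (2 ∣ n) →
    NearlyDispersableWrt (circulant n (2 ∷ 3 ∷ []) (isJumpSet-2,3 n≥7)) (ω n)
theorem5 n n≥7 2∤n =
  let k , 7+k≡n = m≤n⇒∃[o]m+o≡n n≥7
      r , k≡2r  = odd⇒∃r 7+k≡n 2∤n
  in nearlyDispersable n≥7 k 7+k≡n r k≡2r 2∤n
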